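{- Let $G$ be a graph of stability at most two and let $c$ be a proper coloring of $G$. Then $c$ is a b-coloring of $G$ if and only if the set $$M = \{uv : u,v \in V(G),\ u \neq v \text{ and } c(u)=c(v)\}$$ is a strongly maximal matching in the complement graph $\overline{G}$. Moreover, the number of colors used by $c$ is $|V(G)|-|M|$.
   Context: Graphs are finite and simple. The stability of a graph is the maximum cardinality of a set of pairwise non-adjacent vertices. $\overline{G}$ denotes the complement of $G$. A b-coloring of $G$ is a proper coloring of the vertices such that every color class contains a vertex that is adjacent to (i.e. has a neighbor in) every other color class. For a matching $M$ of a graph $H$, $V(M)$ denotes the set of vertices covered by $M$, and an augmenting path for $M$ is a path in $H$ starting and ending outside $V(M)$ whose edges alternate between $E(H)\setminus M$ and $M$. A matching $M$ of $H$ is strongly maximal if $H$ contains no augmenting path of length one or three (number of edges) with respect to $M$. -}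

module Defs where

open import Data.Fin using (Fin; zero; suc; inject₁; fromℕ; toℕ; _≟_; _<?_)
open import Data.Fin.Properties using (any?)
open import Data.Fin.Subset using (Subset; _∈_; ∣_∣)
open import Data.List using (length; filter; allFin; cartesianProduct)
open import Data.Nat using (ℕ; suc; _≤_)
open import Data.Nat.Divisibility using (_∣_; _∤_)
open import Data.Product using (∃-syntax; _×_; _,_)
open import Function.Definitions using (Injective)
open import Level using (0ℓ)
open import Relation.Binary using (Rel; Decidable; Symmetric; Irreflexive)
open import Relation.Binary.PropositionalEquality using (_≡_; _≢_; sym)
open import Relation.Nullary using (¬_)
open import Relation.Nullary.Decidable using (¬?; _×-dec_)
open import Relation.Unary using (Pred)
import Relation.Unary as Unary

-- A set of unordered pairs {u , v} of distinct vertices: Joins u v says that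
-- {u , v} belongs to the set.
record EdgeSet (n : ℕ) : Set₁ where
  field
    Joins  : Rel (Fin n) 0ℓ
    symm   : Symmetric Joins
    irrefl : Irreflexive _≡_ Joins
    joins? : Decidable Joins

open EdgeSet public

-- Each pair is counted once, with its smaller end first.
size : ∀ {n} → EdgeSet n → ℕ
size {n} M = length (filter (λ (u , v) → (u <? v) ×-dec joins? M u v)
                            (cartesianProduct (allFin n) (allFin n)))

Graph : ℕ → Set₁
Graph n = EdgeSet n

Adj : ∀ {n} → Graph n → Rel (Fin n) 0ℓ
Adj = Joins

complement : ∀ {n} → Graph n → Graph n
complement G = record
  { Joins  = λ u v → u ≢ v × ¬ Adj G u v
  ; symm   = λ (u≢v , ¬uv) → (λ v≡u → u≢v (sym v≡u)) , (λ vu → ¬uv (symm G vu))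
  ; irrefl = λ u≡v (u≢v , _) → u≢v u≡v
  ; joins? = λ u v → ¬? (u ≟ v) ×-dec ¬? (joins? G u v)
  }

Stable : ∀ {n} → Graph n → Subset n → Set
Stable G S = ∀ {u v} → u ∈ S → v ∈ S → ¬ Adj G u v

IsStability : ∀ {n} → Graph n → ℕ → Set
IsStability G α = (∃[ S ] Stable G S × ∣ S ∣ ≡ α)
                × (∀ S → Stable G S → ∣ S ∣ ≤ α)

StabilityAtMost : ∀ {n} → Graph n → ℕ → Set
StabilityAtMost G m = ∃[ α ] IsStability G α × α ≤ m

-- The palette Fin k may contain colors that are not used.
Coloring : ℕ → ℕ → Set
Coloring n k = Fin n → Fin k

Proper : ∀ {n k} → Graph n → Coloring n k → Set
Proper G c = ∀ {u v} → Adj G u v → c u ≢ c v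

-- The color classes of c are the (nonempty) fibres over its used colors.
Used : ∀ {n k} → Coloring n k → Pred (Fin k) 0ℓ
Used c i = ∃[ v ] c v ≡ i

used? : ∀ {n k} (c : Coloring n k) → Unary.Decidable (Used c)
used? c i = any? (λ v → c v ≟ i)

numColors : ∀ {n k} → Coloring n k → ℕ
numColors {k = k} c = length (filter (used? c) (allFin k))

BColoring : ∀ {n k} → Graph n → Coloring n k → Set
BColoring G c = Proper G c
  × (∀ i → Used c i →
       ∃[ v ] c v ≡ i
            × (∀ j → Used c j → j ≢ i → ∃[ w ] c w ≡ j × Adj G v w))

Monochromatic : ∀ {n k} → Coloring n k → EdgeSet n
Monochromatic c = record
  { Joins  = λ u v → u ≢ v × c u ≡ c v
  ; symm   = λ (u≢v , eq) → (λ v≡u → u≢v (sym v≡u)) , sym eq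
  ; irrefl = λ u≡v (u≢v , _) → u≢v u≡v
  ; joins? = λ u v → ¬? (u ≟ v) ×-dec (c u ≟ c v)
  }

Matching : ∀ {n} → Graph n → EdgeSet n → Set
Matching H M = (∀ {u v} → Joins M u v → Adj H u v)
             × (∀ {u v w} → Joins M u v → Joins M u w → v ≡ w)

Covered : ∀ {n} → EdgeSet n → Pred (Fin n) 0ℓ
Covered M v = ∃[ w ] Joins M v w

-- A path with ℓ edges is given by its vertices p 0, …, p ℓ; its i-th edge joins
-- p i to p (i + 1), for 0 ≤ i < ℓ.
IsPath : ∀ {n} → Graph n → (ℓ : ℕ) → (Fin (suc ℓ) → Fin n) → Set
IsPath H ℓ p = Injective _≡_ _≡_ p
             × (∀ (i : Fin ℓ) → Adj H (p (inject₁ i)) (p (suc i)))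

-- The first edge of a path that starts outside V(M) is not in M, so the edges
-- in M are those with odd index, counting from 0.
Alternates : ∀ {n} → EdgeSet n → (ℓ : ℕ) → (Fin (suc ℓ) → Fin n) → Set
Alternates M ℓ p = ∀ (i : Fin ℓ) →
    (2 ∣ toℕ i → ¬ Joins M (p (inject₁ i)) (p (suc i)))
  × (2 ∤ toℕ i → Joins M (p (inject₁ i)) (p (suc i)))

AugmentingPath : ∀ {n} → Graph n → EdgeSet n → ℕ → Set
AugmentingPath H M ℓ = ∃[ p ] IsPath H ℓ p
  × ¬ Covered M (p zero) × ¬ Covered M (p (fromℕ ℓ))
  × Alternates M ℓ p

StronglyMaximalMatching : ∀ {n} → Graph n → EdgeSet n → Set
StronglyMaximalMatching H M =
  Matching H M × ¬ AugmentingPath H M 1 × ¬ AugmentingPath H M 3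

module Submission where

-- Stability at most two makes every color class a singleton or a pair, so M is a
-- matching. If v misses some other class, that class is a single vertex x, since
-- two of its vertices would form a stable triple with v; such an x is uncovered
-- and adjacent to v in the complement. Hence a singleton class {v} fails exactly
-- when v x is an augmenting path, and a pair {u , v} fails exactly when u and v
-- miss singletons x and y, which differ (else u, v, x is stable) and give the
-- augmenting path x u v y.

open import Defs
open import Data.Empty using (⊥; ⊥-elim)
open import Data.Fin using (Fin; zero; suc; _<_; _≟_; _<?_)
open import Data.Fin.Properties using (any?; <-cmp; <-asym)
open import Data.Fin.Subset using (Subset; _∈_; ∣_∣; ⁅_⁆; _∪_)
open import Data.Fin.Subset.Properties
  using (x∈⁅x⁆; x∈⁅y⁆⇒x≡y; x∈p∪q⁻; x∈p∪q⁺; x∈p∧x≢y⇒x∈p-y; x∈p⇒∣p-x∣<∣p∣)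
open import Data.Integer using (+_; _-_)
open import Data.Integer.Properties using (m-n≡m⊖n; ⊖-≥)
open import Data.List using ([]; _∷_; length; filter; map; allFin; cartesianProduct)
open import Data.List.Membership.Propositional renaming (_∈_ to _∈ₗ_)
open import Data.List.Membership.Propositional.Properties
  using (∈-map⁺; ∈-map⁻; ∈-filter⁺; ∈-filter⁻; ∈-allFin; ∈-cartesianProduct⁺)
open import Data.List.Membership.Propositional.Properties.WithK using (unique∧set⇒bag)
open import Data.List.Properties using (length-map; length-tabulate)
open import Data.List.Relation.Binary.BagAndSetEquality using (∼bag⇒↭)
open import Data.List.Relation.Binary.Permutation.Propositional.Properties using (↭-length)
import Data.List.Relation.Unary.All as All
import Data.List.Relation.Unary.All.Properties as All
open import Data.List.Relation.Unary.Any using (here; there)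
open import Data.List.Relation.Unary.Unique.Propositional using (Unique; []; _∷_)
open import Data.List.Relation.Unary.Unique.Propositional.Properties
  using (allFin⁺; filter⁺; cartesianProduct⁺)
open import Data.Nat using (ℕ; _+_)
import Data.Nat as ℕ
open import Data.Nat.Divisibility using (divides; _∣?_; _∣0)
open import Data.Nat.Properties using (+-suc; m+n∸n≡m; m≤n+m; ≤-trans)
open import Data.Product using (∃; ∃-syntax; _×_; _,_; proj₁; proj₂)
open import Data.Sum using (_⊎_; inj₁; inj₂)
open import Data.Vec using ([]; _∷_; lookup)
open import Data.Vec.Relation.Unary.All using ([]; _∷_)
open import Data.Vec.Relation.Unary.Unique.Propositional using ([]; _∷_)
open import Data.Vec.Relation.Unary.Unique.Propositional.Properties using (lookup-injective)
open import Function using (_∘_)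
open import Function.Bundles using (_⇔_; mk⇔)
open import Relation.Binary.Definitions using (tri<; tri≈; tri>)
open import Relation.Binary.PropositionalEquality
  using (_≡_; _≢_; refl; sym; trans; cong; cong₂; subst; ≢-sym; module ≡-Reasoning)
open import Relation.Nullary using (¬_; Dec; yes; no)
open import Relation.Nullary.Decidable using (¬?; _×-dec_; from-no; decidable-stable)
open import Relation.Unary using (Pred; Decidable)

-- Stable triples

-- Removing `u`, `v` and `w` in turn lowers the cardinality strictly three times, because each of
-- them is still present when its turn comes.
∣p∣≥3 : ∀ {n} {p : Subset n} {u v w} → u ∈ p → v ∈ p → w ∈ p →
        u ≢ v → u ≢ w → v ≢ w → 3 ℕ.≤ ∣ p ∣
∣p∣≥3 {p = p} {u} {v} {w} u∈p v∈p w∈p u≢v u≢w v≢w =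
  ≤-trans (ℕ.s≤s (≤-trans (ℕ.s≤s (≤-trans (ℕ.s≤s ℕ.z≤n) (x∈p⇒∣p-x∣<∣p∣ w∈p-u-v)))
                          (x∈p⇒∣p-x∣<∣p∣ v∈p-u)))
          (x∈p⇒∣p-x∣<∣p∣ u∈p)
  where
  v∈p-u   = x∈p∧x≢y⇒x∈p-y v∈p (≢-sym u≢v)
  w∈p-u-v = x∈p∧x≢y⇒x∈p-y (x∈p∧x≢y⇒x∈p-y w∈p (≢-sym u≢w)) (≢-sym v≢w)

-- The set `S` of the three vertices would be stable with at least three elements. This is the only
-- form in which the stability bound enters the proof.
no-stable-triple : ∀ {n} (G : Graph n) → StabilityAtMost G 2 →
  ∀ {u v w} → u ≢ v → u ≢ w → v ≢ w →
  ¬ Adj G u v → ¬ Adj G u w → ¬ Adj G v w → ⊥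
no-stable-triple G (α , (_ , bound) , α≤2) {u} {v} {w} u≢v u≢w v≢w ¬uv ¬uw ¬vw =
  from-no (3 ℕ.≤? 2) (≤-trans (≤-trans three (bound S stable)) α≤2)
  where
  S = ⁅ u ⁆ ∪ (⁅ v ⁆ ∪ ⁅ w ⁆)

  three : 3 ℕ.≤ ∣ S ∣
  three = ∣p∣≥3 (x∈p∪q⁺ (inj₁ (x∈⁅x⁆ u)))
                (x∈p∪q⁺ (inj₂ (x∈p∪q⁺ (inj₁ (x∈⁅x⁆ v)))))
                (x∈p∪q⁺ {p = ⁅ u ⁆} (inj₂ (x∈p∪q⁺ {p = ⁅ v ⁆} (inj₂ (x∈⁅x⁆ w)))))
                u≢v u≢w v≢w

  member : ∀ {x} → x ∈ S → x ≡ u ⊎ x ≡ v ⊎ x ≡ w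
  member x∈S with x∈p∪q⁻ ⁅ u ⁆ _ x∈S
  ... | inj₁ x∈u = inj₁ (x∈⁅y⁆⇒x≡y u x∈u)
  ... | inj₂ x∈vw with x∈p∪q⁻ ⁅ v ⁆ _ x∈vw
  ...   | inj₁ x∈v = inj₂ (inj₁ (x∈⁅y⁆⇒x≡y v x∈v))
  ...   | inj₂ x∈w = inj₂ (inj₂ (x∈⁅y⁆⇒x≡y w x∈w))

  stable : Stable G S
  stable x∈S y∈S xy with member x∈S | member y∈S
  ... | inj₁ refl        | inj₁ refl        = irrefl G refl xy
  ... | inj₁ refl        | inj₂ (inj₁ refl) = ¬uv xy
  ... | inj₁ refl        | inj₂ (inj₂ refl) = ¬uw xy
  ... | inj₂ (inj₁ refl) | inj₁ refl        = ¬uv (symm G xy)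
  ... | inj₂ (inj₁ refl) | inj₂ (inj₁ refl) = irrefl G refl xy
  ... | inj₂ (inj₁ refl) | inj₂ (inj₂ refl) = ¬vw xy
  ... | inj₂ (inj₂ refl) | inj₁ refl        = ¬uw (symm G xy)
  ... | inj₂ (inj₂ refl) | inj₂ (inj₁ refl) = ¬vw (symm G xy)
  ... | inj₂ (inj₂ refl) | inj₂ (inj₂ refl) = irrefl G refl xy

-- Counting lists by bijections

module _ {a b} {A : Set a} {B : Set b} (f : A → B) where

  -- Injectivity is asked only on members of `xs`: the maps counted with below, `proj₂` and `c`, are
  -- injective on the filtered lists but not in general.
  map-unique : ∀ {xs} → (∀ {x y} → x ∈ₗ xs → y ∈ₗ xs → f x ≡ f y → x ≡ y) →
               Unique xs → Unique (map f xs)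
  map-unique inj []           = []
  map-unique inj (x∉xs ∷ xs!) =
    All.map⁺ (All.tabulate λ y∈xs fx≡fy →
      All.lookup x∉xs y∈xs (inj (here refl) (there y∈xs) fx≡fy))
    ∷ map-unique (λ x∈xs y∈xs → inj (there x∈xs) (there y∈xs)) xs!

  -- Two duplicate-free lists with the same members are permutations of each other; this is applied
  -- to `map f xs` and `ys`.
  length-bijection : ∀ {xs ys} → Unique xs → Unique ys →
    (∀ {x y} → x ∈ₗ xs → y ∈ₗ xs → f x ≡ f y → x ≡ y) →
    (∀ {x} → x ∈ₗ xs → f x ∈ₗ ys) →
    (∀ {y} → y ∈ₗ ys → ∃[ x ] x ∈ₗ xs × y ≡ f x) →
    length xs ≡ length ys
  length-bijection {xs} {ys} xs! ys! inj into onto =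
    trans (sym (length-map f xs))
          (↭-length (∼bag⇒↭ (unique∧set⇒bag (map-unique inj xs!) ys! (mk⇔ to from))))
    where
    to : ∀ {y} → y ∈ₗ map f xs → y ∈ₗ ys
    to y∈ with ∈-map⁻ f y∈
    ... | _ , x∈xs , refl = into x∈xs

    from : ∀ {y} → y ∈ₗ ys → y ∈ₗ map f xs
    from y∈ with onto y∈
    ... | _ , x∈xs , refl = ∈-map⁺ f x∈xs

length-filter-¬ : ∀ {a p} {A : Set a} {P : Pred A p} (P? : Decidable P) xs →
  length (filter (¬? ∘ P?) xs) + length (filter P? xs) ≡ length xs
length-filter-¬ P? []       = refl
length-filter-¬ P? (x ∷ xs) with P? x
... | yes _ = trans (+-suc _ _) (cong ℕ.suc (length-filter-¬ P? xs))
... | no  _ = cong ℕ.suc (length-filter-¬ P? xs)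

-- Augmenting paths of length one and three

module _ {n} (H : Graph n) (M : EdgeSet n) where

  augmenting₁ : ∀ {x y} → Adj H x y → ¬ Covered M x → ¬ Covered M y → AugmentingPath H M 1
  augmenting₁ {x} {y} xy ¬x ¬y =
    lookup (x ∷ y ∷ [])
    , ( (λ {i} {j} → lookup-injective
          (((λ x≡y → irrefl H x≡y xy) ∷ []) ∷ [] ∷ []) i j)
      , λ { zero → xy })
    , ¬x , ¬y
    , λ { zero → (λ _ xy∈M → ¬x (y , xy∈M)) , λ 2∤0 → ⊥-elim (2∤0 (2 ∣0)) }

  -- Consecutive vertices differ because they are adjacent, and `x ≢ v` and `u ≢ y` hold because `u`
  -- and `v` are covered while `x` and `y` are not. Only the two ends need a separate hypothesis.
  augmenting₃ : ∀ {x u v y} → x ≢ y → Adj H x u → Adj H u v → Adj H v y → Joins M u v →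
                ¬ Covered M x → ¬ Covered M y → AugmentingPath H M 3
  augmenting₃ {x} {u} {v} {y} x≢y xu uv vy uv∈M ¬x ¬y =
    lookup (x ∷ u ∷ v ∷ y ∷ [])
    , ( (λ {i} {j} → lookup-injective
          ( ((λ x≡u → irrefl H x≡u xu)
              ∷ (λ { refl → ¬x (u , symm M uv∈M) })
              ∷ x≢y ∷ [])
          ∷ ((λ u≡v → irrefl H u≡v uv)
              ∷ (λ { refl → ¬y (v , uv∈M) }) ∷ [])
          ∷ ((λ v≡y → irrefl H v≡y vy) ∷ [])
          ∷ [] ∷ []) i j)
      , λ { zero → xu ; (suc zero) → uv ; (suc (suc zero)) → vy })
    , ¬x , ¬y
    , λ { zero             → (λ _ xu∈M → ¬x (u , xu∈M)) , λ 2∤0 → ⊥-elim (2∤0 (2 ∣0))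
        ; (suc zero)       → (λ 2∣1 → ⊥-elim (from-no (2 ∣? 1) 2∣1)) , λ _ → uv∈M
        ; (suc (suc zero)) → (λ _ vy∈M → ¬y (v , symm M vy∈M))
                           , λ 2∤2 → ⊥-elim (2∤2 (divides 1 refl)) }

-- The equivalence, and the number of colors

module _ {n k} (G : Graph n) (c : Coloring n k)
         (stability : StabilityAtMost G 2) (proper : Proper G c) where

  private
    M = Monochromatic c

  matching : Matching (complement G) M
  matching = (λ (u≢v , cu≡cv) → u≢v , λ uv → proper uv cu≡cv) , unique
    where
    unique : ∀ {u v w} → Joins M u v → Joins M u w → v ≡ w
    unique {u} {v} {w} (u≢v , cu≡cv) (u≢w , cu≡cw) = decidable-stable (v ≟ w) λ v≢w →
      no-stable-triple G stability u≢v u≢w v≢w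
        (λ uv → proper uv cu≡cv) (λ uw → proper uw cu≡cw)
        (λ vw → proper vw (trans (sym cu≡cv) cu≡cw))

  uncovered-class : ∀ {u v} → ¬ Covered M u → c u ≡ c v → u ≡ v
  uncovered-class {u} {v} ¬u cu≡cv = decidable-stable (u ≟ v) λ u≢v → ¬u (v , u≢v , cu≡cv)

  pair-class : ∀ {u v x} → Joins M u v → c x ≡ c u → x ≡ u ⊎ x ≡ v
  pair-class {u} {v} {x} uv cx≡cu with x ≟ u
  ... | yes x≡u = inj₁ x≡u
  ... | no  x≢u = inj₂ (proj₂ matching (≢-sym x≢u , sym cx≡cu) uv)

  -- An uncovered `x` is alone in its color class, so `Repels v x` is the obstruction to `v` having
  -- a neighbor in every other class.
  Repels : Fin n → Fin n → Set
  Repels v x = v ≢ x × ¬ Adj G v x × ¬ Covered M x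

  repels? : ∀ v x → Dec (Repels v x)
  repels? v x = ¬? (v ≟ x) ×-dec ¬? (joins? G v x) ×-dec ¬? (any? (joins? M x))

  -- A class that `v` misses cannot contain two vertices `w` and `w′`, as they would form a stable
  -- triple with `v`. It is then a singleton, which `v` repels.
  unrepelled-dominates : ∀ v → ¬ ∃ (Repels v) →
    ∀ j → Used c j → j ≢ c v → ∃[ w ] c w ≡ j × Adj G v w
  unrepelled-dominates v none j (w , refl) cw≢cv with joins? G v w
  ... | yes vw = w , refl , vw
  ... | no ¬vw with any? (joins? M w)
  ...   | no ¬w = ⊥-elim (none (w , (cw≢cv ∘ sym ∘ cong c) , ¬vw , ¬w))
  ...   | yes (w′ , w≢w′ , cw≡cw′) with joins? G v w′
  ...     | yes vw′ = w′ , sym cw≡cw′ , vw′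
  ...     | no ¬vw′ = ⊥-elim
              (no-stable-triple G stability (cw≢cv ∘ sym ∘ cong c)
                (λ v≡w′ → cw≢cv (trans cw≡cw′ (sym (cong c v≡w′)))) w≢w′
                ¬vw ¬vw′ (λ ww′ → proper ww′ cw≡cw′))

  strongly-maximal⇒b-coloring : StronglyMaximalMatching (complement G) M → BColoring G c
  strongly-maximal⇒b-coloring (_ , no₁ , no₃) = proper , dominating
    where
    dominating : ∀ i → Used c i →
      ∃[ v ] c v ≡ i × (∀ j → Used c j → j ≢ i → ∃[ w ] c w ≡ j × Adj G v w)
    dominating _ (u , refl) with any? (repels? u)
    ... | no none = u , refl , unrepelled-dominates u none
    ... | yes (x , u≢x , ¬ux , ¬x) with any? (joins? M u)
    ...   | no ¬u = ⊥-elim (no₁ (augmenting₁ (complement G) M (u≢x , ¬ux) ¬u ¬x))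
    ...   | yes (v , uv@(u≢v , cu≡cv)) with any? (repels? v)
    -- Since `u` and `v` share their color, `v` can represent the class when `u` cannot.
    ...     | no none = v , sym cu≡cv , λ j used j≢cu →
                unrepelled-dominates v none j used λ j≡cv → j≢cu (trans j≡cv (sym cu≡cv))
    ...     | yes (y , v≢y , ¬vy , ¬y) with x ≟ y
    ...       | yes refl = ⊥-elim
                  (no-stable-triple G stability u≢v u≢x v≢y (λ uv → proper uv cu≡cv) ¬ux ¬vy)
    ...       | no  x≢y  = ⊥-elim
                  (no₃ (augmenting₃ (complement G) M x≢y (symm (complement G) (u≢x , ¬ux))
                                    (proj₁ matching uv) (v≢y , ¬vy) uv ¬x ¬y))

  b-coloring⇒strongly-maximal : BColoring G c → StronglyMaximalMatching (complement G) M
  b-coloring⇒strongly-maximal (_ , dominating) = matching , no₁ , no₃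
    where
    no₁ : ¬ AugmentingPath (complement G) M 1
    no₁ (p , (_ , edge) , ¬x , ¬y , _) with edge zero | dominating _ (p zero , refl)
    ... | x≢y , ¬xy | v , cv≡cx , dom
        -- The class of `p zero` is a singleton, so its dominating vertex is `p zero` itself;
        -- likewise the neighbor found in the class of the other end is that end.
        with refl ← uncovered-class ¬x (sym cv≡cx)
        with dom _ (p (suc zero) , refl) (λ cy≡cx → ¬x (_ , x≢y , sym cy≡cx))
    ...   | w , cw≡cy , xw with refl ← uncovered-class ¬y (sym cw≡cy) = ¬xy xw

    no₃ : ¬ AugmentingPath (complement G) M 3
    no₃ (p , (_ , edge) , ¬x , ¬y , alt)
      with edge zero | proj₂ (alt (suc zero)) (from-no (2 ∣? 1)) | edge (suc (suc zero))
         | dominating _ (p (suc zero) , refl)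
    -- The dominating vertex `b` is one of the two inner vertices of the path. Either one misses the
    -- singleton class of the end next to it.
    ... | x≢u , ¬xu | uv@(_ , cu≡cv) | v≢y , ¬vy | b , cb≡cu , dom with pair-class uv cb≡cu
    ...   | inj₁ refl with dom _ (p zero , refl) (λ cx≡cu → ¬x (_ , x≢u , cx≡cu))
    ...     | w , cw≡cx , uw with refl ← uncovered-class ¬x (sym cw≡cx) = ¬xu (symm G uw)
    no₃ (p , (_ , edge) , ¬x , ¬y , alt)
        | x≢u , ¬xu | uv@(_ , cu≡cv) | v≢y , ¬vy | b , cb≡cu , dom
          | inj₂ refl with dom _ (p (suc (suc (suc zero))) , refl)
                           (λ cy≡cu → ¬y (_ , ≢-sym v≢y , trans cy≡cu cu≡cv))
    ...     | w , cw≡cy , vw with refl ← uncovered-class ¬y (sym cw≡cy) = ¬vy vw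

  -- The later vertices of their classes correspond to the edges of M, the
  -- others to the colors.
  Later : Fin n → Set
  Later v = ∃[ u ] u < v × Joins M u v

  later? : Decidable Later
  later? v = any? λ u → (u <? v) ×-dec joins? M u v

  -- An edge listed with its smaller end first is sent to its larger end. This is injective because
  -- a vertex of a matching has only one partner.
  size≡later : size M ≡ length (filter later? (allFin n))
  size≡later = length-bijection proj₂
    (filter⁺ ordered? (cartesianProduct⁺ (allFin⁺ n) (allFin⁺ n)))
    (filter⁺ later? (allFin⁺ n)) inj
    (λ x∈ → ∈-filter⁺ later? (∈-allFin _) (_ , proj₂ (∈-filter⁻ ordered? {xs = pairs} x∈)))
    (λ {v} v∈ → let u , uv = proj₂ (∈-filter⁻ later? {xs = allFin n} v∈) in
      (u , v) , ∈-filter⁺ ordered? (∈-cartesianProduct⁺ (∈-allFin u) (∈-allFin v)) uv , refl)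
    where
    pairs = cartesianProduct (allFin n) (allFin n)

    ordered? : Decidable (λ ((u , v) : Fin n × Fin n) → u < v × Joins M u v)
    ordered? (u , v) = (u <? v) ×-dec joins? M u v

    inj : ∀ {e e′} → e ∈ₗ filter ordered? pairs → e′ ∈ₗ filter ordered? pairs →
          proj₂ e ≡ proj₂ e′ → e ≡ e′
    inj {_ , v} e∈ e′∈ refl = cong (_, v)
      (proj₂ matching (symm M (proj₂ (proj₂ (∈-filter⁻ ordered? {xs = pairs} e∈))))
                      (symm M (proj₂ (proj₂ (∈-filter⁻ ordered? {xs = pairs} e′∈)))))

  -- The bijection is `c` itself: of two vertices with equal colors the larger is later, and every
  -- class keeps its smallest vertex.
  not-later≡numColors : length (filter (¬? ∘ later?) (allFin n)) ≡ numColors c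
  not-later≡numColors = length-bijection c
    (filter⁺ (¬? ∘ later?) (allFin⁺ n)) (filter⁺ (used? c) (allFin⁺ k)) inj
    (λ {v} _ → ∈-filter⁺ (used? c) (∈-allFin (c v)) (v , refl))
    onto
    where
    inj : ∀ {u v} → u ∈ₗ filter (¬? ∘ later?) (allFin n) →
          v ∈ₗ filter (¬? ∘ later?) (allFin n) → c u ≡ c v → u ≡ v
    inj {u} {v} u∈ v∈ cu≡cv with <-cmp u v
    ... | tri< u<v u≢v _ = ⊥-elim
            (proj₂ (∈-filter⁻ (¬? ∘ later?) {xs = allFin n} v∈) (u , u<v , u≢v , cu≡cv))
    ... | tri≈ _ u≡v _   = u≡v
    ... | tri> _ u≢v v<u = ⊥-elim
            (proj₂ (∈-filter⁻ (¬? ∘ later?) {xs = allFin n} u∈)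
              (v , v<u , ≢-sym u≢v , sym cu≡cv))

    onto : ∀ {i} → i ∈ₗ filter (used? c) (allFin k) →
           ∃[ v ] v ∈ₗ filter (¬? ∘ later?) (allFin n) × i ≡ c v
    onto i∈ with proj₂ (∈-filter⁻ (used? c) {xs = allFin k} i∈)
    ... | v , refl with later? v
    ...   | no  ¬later = v , ∈-filter⁺ (¬? ∘ later?) (∈-allFin v) ¬later , refl
    ...   | yes (u , u<v , uv) = u , ∈-filter⁺ (¬? ∘ later?) (∈-allFin u) ¬later , sym (proj₂ uv)
      where
      ¬later : ¬ Later u
      -- The partner of `u` is unique, so `w` is `v`, and `w < u` contradicts `u < v`.
      ¬later (w , w<u , wu) =
        <-asym u<v (subst (_< u) (proj₂ matching (symm M wu) uv) w<u)

  numColors+size : numColors c + size M ≡ n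
  numColors+size = begin
    numColors c + size M
      ≡⟨ cong₂ _+_ (sym not-later≡numColors) size≡later ⟩
    length (filter (¬? ∘ later?) (allFin n)) + length (filter later? (allFin n))
      ≡⟨ length-filter-¬ later? (allFin n) ⟩
    length (allFin n)
      ≡⟨ length-tabulate _ ⟩
    n ∎
    where open ≡-Reasoning

-- The count is proved as a sum of naturals; passing to the integers makes the difference in the
-- theorem a genuine, untruncated one.
m+n≡o⇒+m≡+o-+n : ∀ {m n o} → m + n ≡ o → + m ≡ + o - + n
m+n≡o⇒+m≡+o-+n {m} {n} refl =
  sym (trans (m-n≡m⊖n (m + n) n) (trans (⊖-≥ (m≤n+m n m)) (cong +_ (m+n∸n≡m m n))))

lemma2 : ∀ (n k : ℕ) (G : Graph n) (c : Coloring n k) →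
    StabilityAtMost G 2 → Proper G c →
    (BColoring G c ⇔ StronglyMaximalMatching (complement G) (Monochromatic c))
    × (+ numColors c ≡ + n - + size (Monochromatic c))
lemma2 n k G c stability proper =
  mk⇔ (b-coloring⇒strongly-maximal G c stability proper)
      (strongly-maximal⇒b-coloring G c stability proper)
  , m+n≡o⇒+m≡+o-+n (numColors+size G c stability proper)
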